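{- Let H1 $=i(x,i(y,x))$, H2 $=i(i(x,i(y,z)),i(i(x,y),i(x,z)))$, H3 $=i(i(x,n(x)),n(x))$, H4 $=i(x,i(n(x),y))$. Suppose $A$ is provable from H1–H4 using condensed detachment as the only rule of inference. Then $A$ has a proof from H1–H4 using condensed detachment in which no doubly negated formulas occur except those that occur as subformulas of $A$.
   Context: Formulas are terms built from propositional variables using the binary connective $i$ (implication) and the unary connective $n$ (negation). Condensed detachment: from a major premiss $i(A,B)$ and a minor premiss $C$, after renaming variables so that the two premisses share no variables, if $A$ and $C$ are unifiable with most general unifier $\sigma$, infer $B\sigma$. Alphabetic variants of axioms count as axioms, and conclusions may be renamed. A doubly negated formula is one of the form $n(n(t))$. -}

module Defs where

open import Data.Nat using (ℕ)
open import Data.List using (List; []; _∷_)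
open import Data.List.Membership.Propositional using (_∈_)
open import Data.Product using (∃-syntax; Σ-syntax; _×_)
open import Relation.Nullary using (¬_)
open import Relation.Binary.PropositionalEquality using (_≡_)

data Formula : Set where
  var : ℕ → Formula
  i   : Formula → Formula → Formula
  n   : Formula → Formula

infix 4 _⊑_

data _⊑_ (B : Formula) : Formula → Set where
  here  : B ⊑ B
  left  : ∀ {C D} → B ⊑ C → B ⊑ i C D
  right : ∀ {C D} → B ⊑ D → B ⊑ i C D
  neg   : ∀ {C} → B ⊑ C → B ⊑ n C

Subst : Set
Subst = ℕ → Formula

infixl 8 _[_]

_[_] : Formula → Subst → Formula
var x [ σ ] = σ x
i A B [ σ ] = i (A [ σ ]) (B [ σ ])
n A   [ σ ] = n (A [ σ ])

Variant : Formula → Formula → Set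
Variant A B =
  Σ[ ρ ∈ (ℕ → ℕ) ]
    (∀ x y → var x ⊑ A → var y ⊑ A → ρ x ≡ ρ y → x ≡ y) ×
    B ≡ A [ (λ x → var (ρ x)) ]

Unifies : Subst → Formula → Formula → Set
Unifies σ A B = A [ σ ] ≡ B [ σ ]

-- Generality is compared on all variables, not just those of A and B.  Hence
-- a most general unifier cannot instantiate variables foreign to A and B, and
-- the conclusion of condensed detachment is unique up to renaming.
MGU : Subst → Formula → Formula → Set
MGU σ A B =
  Unifies σ A B ×
  (∀ τ → Unifies τ A B → ∃[ θ ] (∀ x → τ x ≡ σ x [ θ ]))

NoCommonVar : Formula → Formula → Set
NoCommonVar A B = ∀ x → var x ⊑ A → ¬ (var x ⊑ B)

-- CondensedDetachment P Q D : D follows from the major premiss P and the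
-- minor premiss Q.
record CondensedDetachment (P Q D : Formula) : Set where
  field
    A B C         : Formula
    major         : Variant P (i A B)
    minor         : Variant Q C
    renamed-apart : NoCommonVar (i A B) C
    σ             : Subst
    mgu           : MGU σ A C
    conclusion    : Variant (B [ σ ]) D

-- The lines of a proof are listed in reverse order: the last line comes first.
data IsProof (Axiom : Formula → Set) : List Formula → Set where
  empty  : IsProof Axiom []
  axiom  : ∀ {Γ H B} → IsProof Axiom Γ →
           Axiom H → Variant H B → IsProof Axiom (B ∷ Γ)
  detach : ∀ {Γ P Q D} → IsProof Axiom Γ →
           P ∈ Γ → Q ∈ Γ → CondensedDetachment P Q D → IsProof Axiom (D ∷ Γ)

IsProofOf : (Formula → Set) → List Formula → Formula → Set
IsProofOf Axiom Γ A = IsProof Axiom Γ × ∃[ Δ ] Γ ≡ A ∷ Δ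

Provable : (Formula → Set) → Formula → Set
Provable Axiom A = ∃[ Γ ] IsProofOf Axiom Γ A

H1 H2 H3 H4 : Formula
H1 = let x = var 0; y = var 1 in
     i x (i y x)
H2 = let x = var 0; y = var 1; z = var 2 in
     i (i x (i y z)) (i (i x y) (i x z))
H3 = let x = var 0 in
     i (i x (n x)) (n x)
H4 = let x = var 0; y = var 1 in
     i x (i (n x) y)

data H : Formula → Set where
  h1 : H H1
  h2 : H H2
  h3 : H H3
  h4 : H H4

DoublyNegated : Formula → Set
DoublyNegated A = ∃[ t ] A ≡ n (n t)

OccursIn : Formula → List Formula → Set
OccursIn B Γ = ∃[ L ] L ∈ Γ × B ⊑ L

{-# OPTIONS --safe #-}
-- Call a formula good if its doubly negated subformulas all occur in A.
--
-- Consider the Kripke model whose worlds are finite sets Γ of hypotheses and in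
-- which an atom holds at Γ when it is derivable from Γ by modus ponens and
-- instances of H1–H4 with good lines only.  Condensed detachment is sound for
-- it, and for good formulas truth at Γ coincides with such derivability (the
-- argument of normalisation by evaluation), so A has a derivation with good
-- lines, which still uses substitution instances of the axioms.
--
-- To obtain these instances by condensed detachment it suffices to prove
-- i(F,F) for every good F, as detaching an axiom X from i(Xσ,Xσ) yields Xσ.
-- Let V be a negation-free theorem containing all variables of F.  The formulas
-- i(V,i(G,G)) are proved for all subformulas G of F by induction on G, from
-- finitely many theorems that are principal types of combinatory terms; the
-- shared antecedent V prevents the variables of different premisses from
-- drifting apart.
module Submission where

open import Data.Bool using (Bool; false; if_then_else_; _∧_; _∨_; not; T)
open import Data.List using (List; []; _∷_; _++_; map)
open import Data.List.Membership.Propositional using (_∈_)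
open import Data.List.Membership.Propositional.Properties using (∈-++⁺ˡ; ∈-++⁺ʳ)
open import Data.List.Relation.Binary.Subset.Propositional using (_⊆_)
open import Data.List.Relation.Binary.Subset.Propositional.Properties using (⊆-refl; ⊆-trans; xs⊆x∷xs)
open import Data.List.Relation.Unary.All as All using (All; []; _∷_)
open import Data.List.Relation.Unary.All.Properties using (++⁺)
open import Data.List.Relation.Unary.Any using (here; there)
open import Data.Maybe using (Maybe; just; nothing; is-just; to-witness-T; _>>=_)
open import Data.Nat using (ℕ; zero; suc; _+_; _∸_; _⊔_; _≤_; _<_; _<?_; _≤?_; _≟_; _≡ᵇ_; z≤n; s≤s)
open import Data.Nat.Properties using (≤-refl; ≤-trans; <-≤-trans; m≤m⊔n; m≤n⊔m; +-cancelʳ-≡; m+n∸n≡m; m≤n+m; m∸n+n≡m; ≤⇒≯; ≤∧≢⇒<; n≤1+n; ≤-pred)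
open import Data.Product using (∃-syntax; Σ-syntax; _×_; _,_; proj₁; proj₂)
open import Data.Sum using (inj₁; inj₂)
open import Function using (_∘_; id)
open import Relation.Binary.PropositionalEquality using (_≡_; refl; sym; trans; cong; cong₂; subst; module ≡-Reasoning)
open import Relation.Nullary using (¬_; Dec; yes; no; contradiction)
open import Relation.Nullary.Decidable using (map′; _×-dec_; _⊎-dec_)
open import Defs

-- Formulas and substitutions

i-injective : ∀ {A B C D} → i A B ≡ i C D → A ≡ C × B ≡ D
i-injective refl = refl , refl

n-injective : ∀ {A B} → n A ≡ n B → A ≡ B
n-injective refl = refl

var-injective : ∀ {x y} → var x ≡ var y → x ≡ y
var-injective refl = refl

infix 4 _≟ᶠ_

_≟ᶠ_ : (A B : Formula) → Dec (A ≡ B)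
var x ≟ᶠ var y = map′ (cong var) var-injective (x ≟ y)
var _ ≟ᶠ i _ _ = no λ ()
var _ ≟ᶠ n _   = no λ ()
i _ _ ≟ᶠ var _ = no λ ()
i A B ≟ᶠ i C D = map′ (λ (p , q) → cong₂ i p q) i-injective ((A ≟ᶠ C) ×-dec (B ≟ᶠ D))
i _ _ ≟ᶠ n _   = no λ ()
n _   ≟ᶠ var _ = no λ ()
n _   ≟ᶠ i _ _ = no λ ()
n A   ≟ᶠ n B   = map′ (cong n) n-injective (A ≟ᶠ B)

occurs? : ∀ x A → Dec (var x ⊑ A)
occurs? x (var y) = map′ (λ { refl → here }) (λ { here → refl }) (x ≟ y)
occurs? x (i A B) = map′ (λ { (inj₁ p) → left p ; (inj₂ p) → right p })
                         (λ { (left p) → inj₁ p ; (right p) → inj₂ p })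
                         (occurs? x A ⊎-dec occurs? x B)
occurs? x (n A)   = map′ neg (λ { (neg p) → p }) (occurs? x A)

⊑-trans : ∀ {A B C} → A ⊑ B → B ⊑ C → A ⊑ C
⊑-trans p here      = p
⊑-trans p (left q)  = left (⊑-trans p q)
⊑-trans p (right q) = right (⊑-trans p q)
⊑-trans p (neg q)   = neg (⊑-trans p q)

bound : Formula → ℕ
bound (var x) = suc x
bound (i A B) = bound A ⊔ bound B
bound (n A)   = bound A

occurs⇒< : ∀ {x A} → var x ⊑ A → x < bound A
occurs⇒< here                = ≤-refl
occurs⇒< {A = i A B} (left p)  = <-≤-trans (occurs⇒< p) (m≤m⊔n (bound A) (bound B))
occurs⇒< {A = i A B} (right p) = <-≤-trans (occurs⇒< p) (m≤n⊔m (bound A) (bound B))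
occurs⇒< (neg p)             = occurs⇒< p

[]-cong : ∀ A {σ τ} → (∀ x → var x ⊑ A → σ x ≡ τ x) → A [ σ ] ≡ A [ τ ]
[]-cong (var x) e = e x here
[]-cong (i A B) e = cong₂ i ([]-cong A λ x p → e x (left p)) ([]-cong B λ x p → e x (right p))
[]-cong (n A)   e = cong n ([]-cong A λ x p → e x (neg p))

[]-injective : ∀ {A σ τ x} → A [ σ ] ≡ A [ τ ] → var x ⊑ A → σ x ≡ τ x
[]-injective e here      = e
[]-injective e (left p)  = []-injective (proj₁ (i-injective e)) p
[]-injective e (right p) = []-injective (proj₂ (i-injective e)) p
[]-injective e (neg p)   = []-injective (n-injective e) p

[]-∘ : ∀ A σ τ → A [ σ ] [ τ ] ≡ A [ (λ x → σ x [ τ ]) ]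
[]-∘ (var x) σ τ = refl
[]-∘ (i A B) σ τ = cong₂ i ([]-∘ A σ τ) ([]-∘ B σ τ)
[]-∘ (n A)   σ τ = cong n ([]-∘ A σ τ)

[]-var : ∀ A → A [ var ] ≡ A
[]-var (var x) = refl
[]-var (i A B) = cong₂ i ([]-var A) ([]-var B)
[]-var (n A)   = cong n ([]-var A)

⊑-[] : ∀ {A B σ x} → var x ⊑ A → B ⊑ σ x → B ⊑ A [ σ ]
⊑-[] here      q = q
⊑-[] (left p)  q = left (⊑-[] p q)
⊑-[] (right p) q = right (⊑-[] p q)
⊑-[] (neg p)   q = neg (⊑-[] p q)

occurs-renamed : ∀ A {ρ y} → var y ⊑ A [ var ∘ ρ ] → ∃[ x ] (var x ⊑ A × y ≡ ρ x)
occurs-renamed (var x) here      = x , here , refl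
occurs-renamed (i A B) (left p)  = let x , q , e = occurs-renamed A p in x , left q , e
occurs-renamed (i A B) (right p) = let x , q , e = occurs-renamed B p in x , right q , e
occurs-renamed (n A)   (neg p)   = let x , q , e = occurs-renamed A p in x , neg q , e

variant-refl : ∀ A → Variant A A
variant-refl A = id , (λ _ _ _ _ e → e) , sym ([]-var A)

variant-trans : ∀ {A B C} → Variant A B → Variant B C → Variant A C
variant-trans {A} (ρ , ρ-inj , refl) (π , π-inj , refl) =
  π ∘ ρ ,
  (λ x y p q e → ρ-inj x y p q (π-inj (ρ x) (ρ y) (⊑-[] p here) (⊑-[] q here) e)) ,
  []-∘ A (var ∘ ρ) (var ∘ π)

shift : ℕ → Formula → Formula
shift N A = A [ (λ x → var (x + N)) ]

shift-variant : ∀ N A → Variant A (shift N A)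
shift-variant N A = (_+ N) , (λ x y _ _ → +-cancelʳ-≡ N x y) , refl

shift-apart : ∀ A B → NoCommonVar A (shift (bound A) B)
shift-apart A B x p q with occurs-renamed B q
... | y , _ , refl = ≤⇒≯ (m≤n+m (bound A) y) (occurs⇒< p)

alignment : Formula → Formula → List (ℕ × ℕ)
alignment (var x) (var y) = (x , y) ∷ []
alignment (i A B) (i C D) = alignment A C ++ alignment B D
alignment (n A)   (n B)   = alignment A B
alignment _       _       = []

assoc : List (ℕ × ℕ) → ℕ → ℕ
assoc []             x = x
assoc ((y , z) ∷ ps) x = if x ≡ᵇ y then z else assoc ps x

-- The two alignments give candidate renamings in opposite directions. Checking both makes the
-- second a left inverse of the first on the variables of `F`, whence injectivity.
variant? : ∀ F G → Maybe (Variant F G)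
variant? F G with G ≟ᶠ F [ var ∘ assoc (alignment F G) ] | F ≟ᶠ G [ var ∘ assoc (alignment G F) ]
... | yes p | yes q = just (ρ , inj , p)
  where
  ρ π : ℕ → ℕ
  ρ = assoc (alignment F G)
  π = assoc (alignment G F)
  π∘ρ : ∀ x → var x ⊑ F → π (ρ x) ≡ x
  π∘ρ x o = var-injective ([]-injective {F} {var ∘ π ∘ ρ} {var} (trans (sym ([]-∘ F (var ∘ ρ) (var ∘ π)))
    (trans (cong (_[ var ∘ π ]) (sym p)) (trans (sym q) (sym ([]-var F))))) o)
  inj : ∀ x y → var x ⊑ F → var y ⊑ F → ρ x ≡ ρ y → x ≡ y
  inj x y ox oy e = trans (sym (π∘ρ x ox)) (trans (cong π e) (π∘ρ y oy))
... | _ | _ = nothing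

-- Unification

Equations : Set
Equations = List (Formula × Formula)

Solves : Subst → Equations → Set
Solves σ = All λ (A , B) → Unifies σ A B

-- An idempotent most general solution σ is one through which every solution
-- τ factors by τ itself.
PrincipalSolution : Equations → Set
PrincipalSolution E = Σ[ σ ∈ Subst ] Solves σ E × (∀ τ → Solves τ E → ∀ x → τ x ≡ σ x [ τ ])

infix 8 _↦_

_↦_ : ℕ → Formula → Subst
(x ↦ A) y with x ≟ y
... | yes _ = A
... | no  _ = var y

↦-here : ∀ x A → (x ↦ A) x ≡ A
↦-here x A with x ≟ x
... | yes _  = refl
... | no x≢x = contradiction refl x≢x

↦-fresh : ∀ {x} A {B} → ¬ (var x ⊑ B) → B [ x ↦ A ] ≡ B
↦-fresh {x} A {B} x∉B = trans ([]-cong B pointwise) ([]-var B)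
  where
  pointwise : ∀ y → var y ⊑ B → (x ↦ A) y ≡ var y
  pointwise y p with x ≟ y
  ... | yes refl = contradiction p x∉B
  ... | no  _    = refl

↦-absorbed : ∀ x A τ → τ x ≡ A [ τ ] → ∀ y → (x ↦ A) y [ τ ] ≡ τ y
↦-absorbed x A τ e y with x ≟ y
... | yes refl = sym e
... | no  _    = refl

_[_]ᴱ : Equations → Subst → Equations
E [ σ ]ᴱ = map (λ (A , B) → A [ σ ] , B [ σ ]) E

solves-[]⁺ : ∀ E σ τ υ → (∀ x → σ x [ τ ] ≡ υ x) → Solves υ E → Solves τ (E [ σ ]ᴱ)
solves-[]⁺ []            σ τ υ e []       = []
solves-[]⁺ ((A , B) ∷ E) σ τ υ e (p ∷ ps) =
  trans (eq A) (trans p (sym (eq B))) ∷ solves-[]⁺ E σ τ υ e ps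
  where
  eq : ∀ C → C [ σ ] [ τ ] ≡ C [ υ ]
  eq C = trans ([]-∘ C σ τ) ([]-cong C λ x _ → e x)

solves-[]⁻ : ∀ E σ τ → Solves τ (E [ σ ]ᴱ) → Solves (λ x → σ x [ τ ]) E
solves-[]⁻ []            σ τ []       = []
solves-[]⁻ ((A , B) ∷ E) σ τ (p ∷ ps) =
  trans (sym ([]-∘ A σ τ)) (trans p ([]-∘ B σ τ)) ∷ solves-[]⁻ E σ τ ps

transport : ∀ {E F} → (∀ {τ} → Solves τ E → Solves τ F) → (∀ {τ} → Solves τ F → Solves τ E) →
            PrincipalSolution E → PrincipalSolution F
transport f g (σ , s , m) = σ , f s , λ τ t → m τ (g t)

-- A solution equating `var x` with `A` absorbs the binding `x ↦ A`; hence it solves the remaining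
-- equations after elimination and factors through their principal solution.
eliminate : ∀ x A E → ¬ (var x ⊑ A) → PrincipalSolution (E [ x ↦ A ]ᴱ) →
            PrincipalSolution ((var x , A) ∷ E)
eliminate x A E x∉A (σ , s , m) = σ′ , unified ∷ solves-[]⁻ E (x ↦ A) σ s , principal
  where
  σ′ : Subst
  σ′ y = (x ↦ A) y [ σ ]

  unified : σ′ x ≡ A [ σ′ ]
  unified = trans (cong _[ σ ] (trans (↦-here x A) (sym (↦-fresh A x∉A)))) ([]-∘ A (x ↦ A) σ)

  principal : ∀ τ → Solves τ ((var x , A) ∷ E) → ∀ y → τ y ≡ σ′ y [ τ ]
  principal τ (p ∷ ps) y = begin
    τ y                                   ≡⟨ sym (↦-absorbed x A τ p y) ⟩
    (x ↦ A) y [ τ ]                       ≡⟨ []-cong ((x ↦ A) y) (λ z _ → m τ τ-solves z) ⟩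
    (x ↦ A) y [ (λ z → σ z [ τ ]) ]       ≡⟨ sym ([]-∘ ((x ↦ A) y) σ τ) ⟩
    σ′ y [ τ ]                            ∎
    where
    open ≡-Reasoning
    τ-solves : Solves τ (E [ x ↦ A ]ᴱ)
    τ-solves = solves-[]⁺ E (x ↦ A) τ τ (↦-absorbed x A τ p) ps

-- The first argument bounds the number of steps.
unify : ℕ → (E : Equations) → Maybe (PrincipalSolution E)
unify-var : ℕ → ∀ x A E → Maybe (PrincipalSolution ((var x , A) ∷ E))

unify _       []                      = just (var , [] , λ _ _ _ → refl)
unify zero    (_ ∷ _)                 = nothing
unify (suc k) ((var x , A) ∷ E)       = unify-var k x A E
unify (suc k) ((A , var x) ∷ E)       = do
  s ← unify-var k x A E
  just (transport (λ { (p ∷ ps) → sym p ∷ ps }) (λ { (p ∷ ps) → sym p ∷ ps }) s)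
unify (suc k) ((i A B , i C D) ∷ E)   = do
  s ← unify k ((A , C) ∷ (B , D) ∷ E)
  just (transport (λ { (p ∷ q ∷ ps) → cong₂ i p q ∷ ps })
                  (λ { (p ∷ ps) → proj₁ (i-injective p) ∷ proj₂ (i-injective p) ∷ ps }) s)
unify (suc k) ((n A , n B) ∷ E)       = do
  s ← unify k ((A , B) ∷ E)
  just (transport (λ { (p ∷ ps) → cong n p ∷ ps }) (λ { (p ∷ ps) → n-injective p ∷ ps }) s)
unify (suc k) (_ ∷ E)                 = nothing

unify-var k x A E with var x ≟ᶠ A
... | yes refl = do
  s ← unify k E
  just (transport (refl ∷_) (λ { (_ ∷ ps) → ps }) s)
... | no  _ with occurs? x A
...   | yes _   = nothing
...   | no  x∉A = do
  s ← unify k (E [ x ↦ A ]ᴱ)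
  just (eliminate x A E x∉A s)

-- Condensed detachment with premisses sharing variables: σ acts on the major
-- and υ on the minor premiss, and (σ , υ) is most general as a pair.
detachment : ∀ A B C (σ υ : Subst) → A [ σ ] ≡ C [ υ ] →
  (∀ τ τ′ → A [ τ ] ≡ C [ τ′ ] → ∃[ θ ]
     ((∀ x → var x ⊑ i A B → τ x ≡ σ x [ θ ]) × (∀ x → var x ⊑ C → τ′ x ≡ υ x [ θ ]))) →
  CondensedDetachment (i A B) C (B [ σ ])
detachment A B C σ υ unified general = record
  { A = A ; B = B ; C = shift N C
  ; major = variant-refl (i A B)
  ; minor = shift-variant N C
  ; renamed-apart = shift-apart (i A B) C
  ; σ = ω
  ; mgu = ω-unifies , ω-general
  ; conclusion = subst (λ D → Variant D (B [ σ ])) (sym ([]-cong B λ x p → ω-major x (right p)))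
                       (variant-refl (B [ σ ]))
  }
  where
  N M : ℕ
  N = bound (i A B)
  M = bound (i A B [ σ ])

  -- `MGU` compares all variables, so those foreign to both premisses must stay free: they move to
  -- variables from `M` on, clear of all those introduced by the other two cases.
  ω : Subst
  ω x with occurs? x (i A B) | (N ≤? x) ×-dec occurs? (x ∸ N) C
  ... | yes _ | _     = σ x
  ... | no _  | yes _ = υ (x ∸ N)
  ... | no _  | no _  = var (x + M)

  ω-major : ∀ x → var x ⊑ i A B → ω x ≡ σ x
  ω-major x p with occurs? x (i A B) | (N ≤? x) ×-dec occurs? (x ∸ N) C
  ... | yes _ | _ = refl
  ... | no ¬p | _ = contradiction p ¬p

  ω-minor : ∀ x → var x ⊑ C → ω (x + N) ≡ υ x
  ω-minor x p with occurs? (x + N) (i A B) | (N ≤? x + N) ×-dec occurs? (x + N ∸ N) C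
  ... | yes q | _     = contradiction (occurs⇒< q) (≤⇒≯ (m≤n+m N x))
  ... | no _  | yes _ = cong υ (m+n∸n≡m x N)
  ... | no _  | no ¬q = contradiction (m≤n+m N x , subst (λ y → var y ⊑ C) (sym (m+n∸n≡m x N)) p) ¬q

  ω-unifies : A [ ω ] ≡ shift N C [ ω ]
  ω-unifies = begin
    A [ ω ]                       ≡⟨ []-cong A (λ x p → ω-major x (left p)) ⟩
    A [ σ ]                       ≡⟨ unified ⟩
    C [ υ ]                       ≡⟨ []-cong C (λ x p → sym (ω-minor x p)) ⟩
    C [ (λ x → ω (x + N)) ]       ≡⟨ sym ([]-∘ C (λ x → var (x + N)) ω) ⟩
    shift N C [ ω ]               ∎
    where open ≡-Reasoning

  ω-general : ∀ τ → A [ τ ] ≡ shift N C [ τ ] → ∃[ θ ] (∀ x → τ x ≡ ω x [ θ ])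
  ω-general τ e with general τ (λ x → τ (x + N)) (trans e ([]-∘ C _ τ))
  ... | θ , on-major , on-minor = θ′ , factor
    where
    θ′ : Subst
    θ′ y with y <? M
    ... | yes _ = θ y
    ... | no  _ = τ (y ∸ M)

    θ′-below : ∀ y → y < M → θ′ y ≡ θ y
    θ′-below y y<M with y <? M
    ... | yes _ = refl
    ... | no ¬p = contradiction y<M ¬p

    θ′-above : ∀ x → θ′ (x + M) ≡ τ x
    θ′-above x with x + M <? M
    ... | yes p = contradiction p (≤⇒≯ (m≤n+m M x))
    ... | no  _ = cong τ (m+n∸n≡m x M)

    factor : ∀ x → τ x ≡ ω x [ θ′ ]
    factor x with occurs? x (i A B) | (N ≤? x) ×-dec occurs? (x ∸ N) C
    ... | yes p | _ = trans (on-major x p)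
      ([]-cong (σ x) λ y q → sym (θ′-below y (occurs⇒< (⊑-[] p q))))
    -- `unified` places the variables of this value of `υ` in `A [ σ ]`, hence below `M`.
    ... | no _ | yes (N≤x , p) = trans (cong τ (sym (m∸n+n≡m N≤x))) (trans (on-minor (x ∸ N) p)
      ([]-cong (υ (x ∸ N)) λ y q → sym (θ′-below y (occurs⇒<
        (left {D = B [ σ ]} (subst (var y ⊑_) (sym unified) (⊑-[] p q)))))))
    ... | no _ | no _ = sym (θ′-above x)

-- Combinatory terms over the axioms

infixl 7 _·_

-- `H1` and `H2` are the principal types of the combinators K and S. Application is typed by
-- condensed detachment, so a typable closed term encodes a proof.
data Term : Set where
  ax  : ∀ {X} → H X → Term
  v   : ℕ → Term
  _·_ : Term → Term → Term

free : ℕ → Term → Bool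
free x (ax _)  = false
free x (v y)   = x ≡ᵇ y
free x (s · t) = free x s ∨ free x t

is-var : ℕ → Term → Bool
is-var x (v y) = x ≡ᵇ y
is-var x _     = false

infixr 6 ƛ_⇒_

-- Bracket abstraction.  Its η-rule keeps the terms small enough to be typed by
-- evaluation, at the price of possibly more general types.
ƛ_⇒_ : ℕ → Term → Term
ƛ x ⇒ ax h    = ax h1 · ax h
ƛ x ⇒ v y     = if x ≡ᵇ y then ax h2 · ax h1 · ax h1 else ax h1 · v y
ƛ x ⇒ (s · t) = if free x (s · t)
  then (if is-var x t ∧ not (free x s) then s else ax h2 · (ƛ x ⇒ s) · (ƛ x ⇒ t))
  else ax h1 · (s · t)

++-proof : ∀ {Axiom Γ Δ} → IsProof Axiom Γ → IsProof Axiom Δ → IsProof Axiom (Γ ++ Δ)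
++-proof empty            q = q
++-proof (axiom p h w)    q = axiom (++-proof p q) h w
++-proof (detach p m k d) q = detach (++-proof p q) (∈-++⁺ˡ m) (∈-++⁺ˡ k) d

-- Proof trees all of whose lines are good

module _ (A₀ : Formula) where

  Good : Formula → Set
  Good F = ∀ {B} → DoublyNegated B → B ⊑ F → B ⊑ A₀

  good-⊑ : ∀ {F G} → F ⊑ G → Good G → Good F
  good-⊑ p g d q = g d (⊑-trans q p)

  good-var : ∀ {x} → Good (var x)
  good-var (_ , refl) ()

  good-i : ∀ {F G} → Good F → Good G → Good (i F G)
  good-i f g (_ , ()) here
  good-i f g d (left p)  = f d p
  good-i f g d (right p) = g d p

  good-self : Good A₀
  good-self _ p = p

  -- `A₀` is arbitrary, so evaluation certifies only formulas free of double negation; the lines of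
  -- the proofs found by `infer` are of this kind.
  good? : ∀ F → Maybe (Good F)
  good? (var x)       = just good-var
  good? (i F G)       = do
    f ← good? F
    g ← good? G
    just (good-i f g)
  good? (n (var x))   = just λ { (_ , ()) here ; (_ , refl) (neg ()) }
  good? (n (i F G))   = do
    f ← good? (i F G)
    just λ { (_ , ()) here ; d (neg p) → f d p }
  good? (n (n F))     = nothing

  data Thm : Formula → Set where
    axiom  : ∀ {X F} → H X → Variant X F → Good F → Thm F
    detach : ∀ {P Q F} → Thm P → Thm Q → CondensedDetachment P Q F → Good F → Thm F

  thm-good : ∀ {F} → Thm F → Good F
  thm-good (axiom _ _ g)    = g
  thm-good (detach _ _ _ g) = g

  thm-variant : ∀ {F G} → Thm F → Variant F G → Good G → Thm G
  thm-variant (axiom h u _)    w g = axiom h (variant-trans u w) g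
  thm-variant (detach p q d _) w g =
    detach p q (record { CondensedDetachment d ; conclusion = variant-trans (CondensedDetachment.conclusion d) w }) g

  unified-detachment : ∀ {P Q} → Thm P → Thm Q → Maybe (∃[ F ] Thm F)
  unified-detachment {i A B} {C} p q = do
    -- 1000 is a step budget, sufficient for the terms checked below.
    (σ , (e ∷ []) , m) ← unify 1000 ((A , shift (bound (i A B)) C) ∷ [])
    g ← good? (B [ σ ])
    just (B [ σ ] , detach p q (record
      { A = A ; B = B ; C = shift (bound (i A B)) C
      ; major = variant-refl (i A B)
      ; minor = shift-variant (bound (i A B)) C
      ; renamed-apart = shift-apart (i A B) C
      ; σ = σ
      ; mgu = e , λ τ u → τ , m τ (u ∷ [])
      ; conclusion = variant-refl (B [ σ ])
      }) g)
  unified-detachment _ _ = nothing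

  infer : Term → Maybe (∃[ F ] Thm F)
  infer (ax {X} h) = do
    g ← good? X
    just (X , axiom h (variant-refl X) g)
  infer (v _)   = nothing
  infer (s · t) = do
    (_ , p) ← infer s
    (_ , q) ← infer t
    unified-detachment p q

  typecheck : Term → ∀ F → Maybe (Thm F)
  typecheck t F = do
    (G , p) ← infer t
    w ← variant? G F
    g ← good? F
    just (thm-variant p w g)

  by-term : ∀ {F} t → T (is-just (typecheck t F)) → Thm F
  by-term t = to-witness-T (typecheck t _)

  -- The numbering matters: variable 0 is absent from the antecedent, so `detach-general` with
  -- `N = suc m` sends it exactly to the next variable of `env`. The same holds for `id-new` and
  -- `id-old`.
  weakening : Thm (i (var 1) (i (var 0) (var 1)))
  weakening = by-term (ax h1) _

  reflexivity : Thm (i (var 0) (var 0))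
  reflexivity = by-term (ƛ 0 ⇒ v 0) _

  id-initial : Thm (i (i (var 0) (var 0)) (i (var 0) (var 0)))
  id-initial = by-term (ƛ 0 ⇒ ƛ 1 ⇒ v 0 · (v 0 · v 1)) _

  -- The expression discarded by `ax h1` ties the types together. When the antecedent is matched
  -- with `Id m (var 0)`, the part `i (var 0) (var 1)` becomes `env (suc m)`.
  id-new : Thm (i (i (var 1) (var 2)) (i (i (var 0) (var 1)) (i (var 0) (var 0))))
  id-new = by-term (ƛ 0 ⇒ ƛ 1 ⇒ ƛ 2 ⇒ ax h1 · v 2 · (v 0 · (v 1 · v 2))) _

  id-old : Thm (i (i (var 1) (i (var 2) (var 3))) (i (i (var 0) (var 1)) (i (var 2) (var 2))))
  id-old = by-term (ƛ 0 ⇒ ƛ 1 ⇒ ƛ 2 ⇒ ax h1 · v 2 · (ƛ 3 ⇒ v 0 · (v 1 · v 3) · v 2)) _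

  id-implication : Thm (i (i (var 2) (i (var 3) (var 4))) (i (i (var 2) (i (var 0) (var 1)))
                         (i (var 2) (i (i (var 4) (var 0)) (i (var 3) (var 1))))))
  id-implication = by-term (ƛ 0 ⇒ ƛ 1 ⇒ ƛ 2 ⇒ ƛ 3 ⇒ ƛ 4 ⇒ v 1 · v 2 · (v 3 · (v 0 · v 2 · v 4))) _

  -- Contraposition: given `n (var 4)`, `H4` leads from `var 3` to `n (var 3)`, and `H3` discharges
  -- `var 3`.
  id-negation : Thm (i (i (var 2) (i (var 3) (var 4))) (i (var 2) (i (n (var 4)) (n (var 3)))))
  id-negation = by-term (ƛ 0 ⇒ ƛ 1 ⇒ ƛ 2 ⇒ ax h3 · (ƛ 3 ⇒ ax h4 · (v 0 · v 1 · v 3) · v 2)) _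

  -- Exact instances of theorems

  extend : Formula → Subst → ℕ → Subst
  extend A ρ N x with occurs? x A
  ... | yes _ = ρ x
  ... | no  _ = var (x + N)

  -- The minor premiss is an instance of the antecedent; the remaining
  -- variables of the consequent are moved above N.
  detach-general : ∀ {A B} ρ N → (∀ x → var x ⊑ A [ ρ ] → x < N) → Thm (i A B) → Thm (A [ ρ ]) →
                   Good (B [ extend A ρ N ]) → Thm (B [ extend A ρ N ])
  detach-general {A} {B} ρ N below p q = detach p q
    (detachment A B (A [ ρ ]) (extend A ρ N) var
      (trans ([]-cong A extend-inside) (sym ([]-var (A [ ρ ])))) general)
    where
    extend-inside : ∀ x → var x ⊑ A → extend A ρ N x ≡ ρ x
    extend-inside x o with occurs? x A
    ... | yes _ = refl
    ... | no ¬o = contradiction o ¬o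

    general : ∀ τ τ′ → A [ τ ] ≡ A [ ρ ] [ τ′ ] → ∃[ θ ]
      ((∀ x → var x ⊑ i A B → τ x ≡ extend A ρ N x [ θ ]) × (∀ x → var x ⊑ A [ ρ ] → τ′ x ≡ θ x))
    general τ τ′ e = θ , (λ x _ → on-major x) , λ x o → sym (θ-below x (below x o))
      where
      θ : Subst
      θ y with y <? N
      ... | yes _ = τ′ y
      ... | no  _ = τ (y ∸ N)

      θ-below : ∀ y → y < N → θ y ≡ τ′ y
      θ-below y y<N with y <? N
      ... | yes _ = refl
      ... | no ¬p = contradiction y<N ¬p

      θ-above : ∀ x → θ (x + N) ≡ τ x
      θ-above x with x + N <? N
      ... | yes p = contradiction p (≤⇒≯ (m≤n+m N x))
      ... | no  _ = cong τ (m+n∸n≡m x N)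

      on-major : ∀ x → τ x ≡ extend A ρ N x [ θ ]
      on-major x with occurs? x A
      ... | yes o = trans ([]-injective (trans e ([]-∘ A ρ τ′)) o)
                          ([]-cong (ρ x) λ y r → sym (θ-below y (below y (⊑-[] o r))))
      ... | no  _ = sym (θ-above x)

  -- Here instead the antecedent is an instance of the minor premiss, and
  -- nothing in the consequent gets instantiated.
  detach-special : ∀ {B} C ρ → Thm (i (C [ ρ ]) B) → Thm C → Thm B
  detach-special {B} C ρ p q = detach p q
    (subst (CondensedDetachment _ C) ([]-var B)
      (detachment (C [ ρ ]) B C var ρ ([]-var (C [ ρ ])) λ τ τ′ e →
        τ , (λ _ _ → refl) , λ x o → sym ([]-injective (trans (sym ([]-∘ C ρ τ)) e) o)))
    (good-⊑ (right here) (thm-good p))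

  -- The unifier merely undoes the renaming apart of the minor premiss, so the conclusion is not
  -- instantiated.
  modus-ponens : ∀ {A B} → Thm (i A B) → Thm A → Thm B
  modus-ponens {A} {B} p q = detach-special A var (subst (λ C → Thm (i C B)) (sym ([]-var A)) p) q

  -- A theorem containing exactly the variables 0,…,m.  Used as a common
  -- antecedent it keeps the variables of two premisses synchronised: unifying
  -- the antecedents undoes the renaming apart.
  env : ℕ → Formula
  env zero    = i (var 0) (var 0)
  env (suc m) = i (var (suc m)) (env m)

  env-< : ∀ m {x} → var x ⊑ env m → x < suc m
  env-< zero    (left here)  = ≤-refl
  env-< zero    (right here) = ≤-refl
  env-< (suc m) (left here)  = ≤-refl
  env-< (suc m) (right p)    = ≤-trans (env-< m p) (n≤1+n _)

  env-∋ : ∀ m {x} → x < suc m → var x ⊑ env m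
  env-∋ zero    (s≤s z≤n) = left here
  env-∋ (suc m) {x} x<2+m with x ≟ suc m
  ... | yes refl = left here
  ... | no x≢1+m = right (env-∋ m (≤∧≢⇒< (≤-pred x<2+m) x≢1+m))

  good-env : ∀ m → Good (env m)
  good-env zero    = good-i good-var good-var
  good-env (suc m) = good-i good-var (good-env m)

  env-thm : ∀ m → Thm (env m)
  env-thm zero    = reflexivity
  env-thm (suc m) =
    detach-general (λ _ → env m) (suc m) (λ _ → env-< m) weakening (env-thm m) (good-env (suc m))

  Id : ℕ → Formula → Formula
  Id m α = i (env m) (i α α)

  good-Id : ∀ m {α} → Good α → Good (Id m α)
  good-Id m g = good-i (good-env m) (good-i g g)

  Bounded : ℕ → Formula → Set
  Bounded m α = ∀ {x} → var x ⊑ α → x < suc m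

  Id-< : ∀ m {α} → Bounded m α → ∀ x → var x ⊑ Id m α → x < suc m
  Id-< m b x (left p)          = env-< m p
  Id-< m b x (right (left p))  = b p
  Id-< m b x (right (right p)) = b p

  id-var : ∀ m {x} → x < suc m → Thm (Id m (var x))
  id-var zero    (s≤s z≤n) = id-initial
  id-var (suc m) {x} x<2+m with x ≟ suc m
  ... | yes refl = detach-general ρ (suc m) (Id-< m λ { here → s≤s z≤n }) id-new
                     (id-var m {0} (s≤s z≤n)) (good-Id (suc m) good-var)
    where
    ρ : Subst
    ρ 1 = env m
    ρ _ = i (var 0) (var 0)
  ... | no x≢1+m = detach-general ρ (suc m) (Id-< m λ { here → x<1+m }) id-old
                     (id-var m x<1+m) (good-Id (suc m) good-var)
    where
    x<1+m : x < suc m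
    x<1+m = ≤∧≢⇒< (≤-pred x<2+m) x≢1+m
    ρ : Subst
    ρ 1 = env m
    ρ _ = var x

  id-n : ∀ m {α} → Bounded m α → Good (n α) → Thm (Id m α) → Thm (Id m (n α))
  id-n m {α} b g p = detach-general ρ (suc m) (Id-< m b) id-negation p (good-Id m g)
    where
    ρ : Subst
    ρ 2 = env m
    ρ _ = α

  -- Detaching the identity for `α` first leaves two placeholder variables beyond those of `env m`;
  -- the second detachment fills both with `β`.
  id-i : ∀ m {α β} → Bounded m α → Bounded m β → Thm (Id m α) → Thm (Id m β) → Thm (Id m (i α β))
  id-i m {α} {β} bα bβ p q = detach p′ q
      (subst (CondensedDetachment _ (Id m β)) consequent-σ
        (detachment antecedent consequent (Id m β) σ var
          (trans antecedent-σ (sym ([]-var (Id m β)))) general))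
      (good-Id m (good-i gα gβ))
    where
    gα : Good α
    gα = good-⊑ (right (left here)) (thm-good p)
    gβ : Good β
    gβ = good-⊑ (right (left here)) (thm-good q)

    N : ℕ
    N = suc m

    antecedent consequent : Formula
    antecedent = i (env m) (i (var N) (var (suc N)))
    consequent = i (env m) (i (i α (var N)) (i α (var (suc N))))

    p′ : Thm (i antecedent consequent)
    p′ = detach-general ρ N (Id-< m bα) id-implication p
      (good-i (good-i (good-env m) (good-i good-var good-var))
              (good-i (good-env m) (good-i (good-i gα good-var) (good-i gα good-var))))
      where
      ρ : Subst
      ρ 2 = env m
      ρ _ = α

    σ : Subst
    σ x with x <? N
    ... | yes _ = var x
    ... | no  _ = β

    σ-below : ∀ x → x < N → σ x ≡ var x
    σ-below x x<N with x <? N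
    ... | yes _ = refl
    ... | no ¬p = contradiction x<N ¬p

    σ-above : ∀ x → N ≤ x → σ x ≡ β
    σ-above x N≤x with x <? N
    ... | yes p = contradiction p (≤⇒≯ N≤x)
    ... | no  _ = refl

    σ-fixes : ∀ F → Bounded m F → F [ σ ] ≡ F
    σ-fixes F b = trans ([]-cong F λ x o → σ-below x (b o)) ([]-var F)

    antecedent-σ : antecedent [ σ ] ≡ Id m β
    antecedent-σ = cong₂ i (σ-fixes (env m) (env-< m))
      (cong₂ i (σ-above N ≤-refl) (σ-above (suc N) (n≤1+n N)))

    consequent-σ : consequent [ σ ] ≡ Id m (i α β)
    consequent-σ = cong₂ i (σ-fixes (env m) (env-< m))
      (cong₂ i (cong₂ i (σ-fixes α bα) (σ-above N ≤-refl))
               (cong₂ i (σ-fixes α bα) (σ-above (suc N) (n≤1+n N))))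

    general : ∀ τ τ′ → antecedent [ τ ] ≡ Id m β [ τ′ ] → ∃[ θ ]
      ((∀ x → var x ⊑ i antecedent consequent → τ x ≡ σ x [ θ ]) ×
       (∀ x → var x ⊑ Id m β → τ′ x ≡ θ x))
    general τ τ′ e = τ , on-major , λ x o → sym (agree (Id-< m bβ x o))
      where
      -- The shared antecedent `env m` contains every variable below `N`, so unifying its two copies
      -- makes `τ` and `τ′` agree there. Hence `τ` itself is the factor.
      agree : ∀ {x} → x < N → τ x ≡ τ′ x
      agree x<N = []-injective (proj₁ (i-injective e)) (env-∋ m x<N)

      β-agree : β [ τ′ ] ≡ β [ τ ]
      β-agree = []-cong β λ _ o → sym (agree (bβ o))

      low : ∀ {x} → x < N → τ x ≡ σ x [ τ ]
      low {x} x<N = cong _[ τ ] (sym (σ-below x x<N))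

      high₀ : τ N ≡ σ N [ τ ]
      high₀ = trans (proj₁ (i-injective (proj₂ (i-injective e))))
        (trans β-agree (cong _[ τ ] (sym (σ-above N ≤-refl))))

      high₁ : τ (suc N) ≡ σ (suc N) [ τ ]
      high₁ = trans (proj₂ (i-injective (proj₂ (i-injective e))))
        (trans β-agree (cong _[ τ ] (sym (σ-above (suc N) (n≤1+n N)))))

      on-major : ∀ x → var x ⊑ i antecedent consequent → τ x ≡ σ x [ τ ]
      on-major x (left (left o))                     = low (env-< m o)
      on-major _ (left (right (left here)))          = high₀
      on-major _ (left (right (right here)))         = high₁
      on-major x (right (left o))                    = low (env-< m o)
      on-major x (right (right (left (left o))))     = low (bα o)
      on-major _ (right (right (left (right here)))) = high₀
      on-major x (right (right (right (left o))))    = low (bα o)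
      on-major _ (right (right (right (right here)))) = high₁

  id-formula : ∀ m α → Bounded m α → Good α → Thm (Id m α)
  id-formula m (var x) b g = id-var m (b here)
  id-formula m (i α β) b g = id-i m (b ∘ left) (b ∘ right)
    (id-formula m α (b ∘ left) (good-⊑ (left here) g))
    (id-formula m β (b ∘ right) (good-⊑ (right here) g))
  id-formula m (n α)   b g = id-n m (b ∘ neg) g (id-formula m α (b ∘ neg) (good-⊑ (neg here) g))

  identity : ∀ α → Good α → Thm (i α α)
  identity α g = modus-ponens
    (id-formula (bound α) α (λ o → ≤-trans (occurs⇒< o) (n≤1+n _)) g)
    (env-thm (bound α))

  axiom-instance : ∀ {X} → H X → ∀ σ → Good (X [ σ ]) → Thm (X [ σ ])
  axiom-instance {X} h σ g = detach-special X σ (identity (X [ σ ]) g) (axiom h (variant-refl X) (good-axiom h))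
    where
    good-axiom : ∀ {X} → H X → Good X
    good-axiom h1 = to-witness-T (good? H1) _
    good-axiom h2 = to-witness-T (good? H2) _
    good-axiom h3 = to-witness-T (good? H3) _
    good-axiom h4 = to-witness-T (good? H4) _

  -- Derivations from hypotheses with good lines

  infix 3 _⊢_ _⊩_

  data _⊢_ (Γ : List Formula) : Formula → Set where
    hyp : ∀ {F} → Good F → F ∈ Γ → Γ ⊢ F
    ax  : ∀ {X} → H X → ∀ σ → Good (X [ σ ]) → Γ ⊢ X [ σ ]
    mp  : ∀ {F G} → Γ ⊢ i F G → Γ ⊢ F → Γ ⊢ G

  ⊢-good : ∀ {Γ F} → Γ ⊢ F → Good F
  ⊢-good (hyp g _)  = g
  ⊢-good (ax _ _ g) = g
  ⊢-good (mp d _)   = good-⊑ (right here) (⊢-good d)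

  ⊢-weaken : ∀ {Γ Δ F} → Γ ⊆ Δ → Γ ⊢ F → Δ ⊢ F
  ⊢-weaken s (hyp g p)  = hyp g (s p)
  ⊢-weaken s (ax h σ g) = ax h σ g
  ⊢-weaken s (mp d e)   = mp (⊢-weaken s d) (⊢-weaken s e)

  values : Formula → Formula → Formula → Subst
  values F G K 0 = F
  values F G K 1 = G
  values F G K _ = K

  ⊢-K : ∀ {Γ F G} → Good F → Good G → Γ ⊢ i F (i G F)
  ⊢-K {F = F} {G} f g = ax h1 (values F G G) (good-i f (good-i g f))

  ⊢-S : ∀ {Γ F G K} → Good F → Good G → Good K → Γ ⊢ i (i F (i G K)) (i (i F G) (i F K))
  ⊢-S {F = F} {G} {K} f g k = ax h2 (values F G K)
    (good-i (good-i f (good-i g k)) (good-i (good-i f g) (good-i f k)))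

  ⊢-contradiction : ∀ {Γ F G} → Good G → Γ ⊢ F → Γ ⊢ n F → Γ ⊢ G
  ⊢-contradiction {F = F} {G} g d e =
    mp (mp (ax h4 (values F G G) (good-i (⊢-good d) (good-i (⊢-good e) g))) d) e

  -- The usual argument with K and S stays among good lines because `i` creates no doubly negated
  -- formula.
  deduction : ∀ {Γ F G} → Good F → F ∷ Γ ⊢ G → Γ ⊢ i F G
  deduction f (hyp _ (here refl)) = mp (mp (⊢-S f (good-i f f) f) (⊢-K f (good-i f f))) (⊢-K f f)
  deduction f (hyp g (there p))   = mp (⊢-K g f) (hyp g p)
  deduction f (ax h σ g)          = mp (⊢-K g f) (ax h σ g)
  deduction f (mp d e)            =
    mp (mp (⊢-S f (⊢-good e) (good-⊑ (right here) (⊢-good d))) (deduction f d)) (deduction f e)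

  ⊢-n : ∀ {Γ F} → Good (n F) → F ∷ Γ ⊢ n F → Γ ⊢ n F
  ⊢-n {F = F} g d = mp (ax h3 (values F F F) (good-i (good-i f g) g)) (deduction f d)
    where
    f : Good F
    f = good-⊑ (neg here) g

  -- The Kripke model whose worlds are contexts

  -- Falsity in the model. Explosion is restricted to good formulas because by `⊢-good` no others
  -- are derivable.
  Absurd : List Formula → Set
  Absurd Γ = ∀ F → Good F → Γ ⊢ F

  -- Forcing covers all formulas, since the given proof may contain lines that are not good.
  _⊩_ : List Formula → Formula → Set
  Γ ⊩ var x = Γ ⊢ var x
  Γ ⊩ i F G = ∀ {Δ} → Γ ⊆ Δ → Δ ⊩ F → Δ ⊩ G
  Γ ⊩ n F   = ∀ {Δ} → Γ ⊆ Δ → Δ ⊩ F → Absurd Δ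

  ⊩-mono : ∀ F {Γ Δ} → Γ ⊆ Δ → Γ ⊩ F → Δ ⊩ F
  ⊩-mono (var x) s d = ⊢-weaken s d
  ⊩-mono (i F G) s f = λ t → f (⊆-trans s t)
  ⊩-mono (n F)   s f = λ t → f (⊆-trans s t)

  -- Explosion reaches even formulas that are not good: the induction ends at atoms, which are
  -- always good, or at negations, where absurdity persists to larger worlds. This validates every
  -- instance of `H4`.
  ⊩-absurd : ∀ F {Γ} → Absurd Γ → Γ ⊩ F
  ⊩-absurd (var x) a = a (var x) good-var
  ⊩-absurd (i F G) a = λ s _ → ⊩-absurd G λ K g → ⊢-weaken s (a K g)
  ⊩-absurd (n F)   a = λ s _ K g → ⊢-weaken s (a K g)

  reify   : ∀ F {Γ} → Good F → Γ ⊩ F → Γ ⊢ F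
  reflect : ∀ F {Γ} → Γ ⊢ F → Γ ⊩ F

  reify (var x) g d = d
  reify (i F G) g f = deduction gF (reify G (good-⊑ (right here) g) (f (xs⊆x∷xs _ F) (reflect F (hyp gF (here refl)))))
    where
    gF : Good F
    gF = good-⊑ (left here) g
  -- Adding `F` makes the world absurd; taking `n F` itself as the absurd conclusion is what lets
  -- `H3` close the derivation.
  reify (n F) g f = ⊢-n g (f (xs⊆x∷xs _ F) (reflect F (hyp (good-⊑ (neg here) g) (here refl))) (n F) g)

  reflect (var x) d = d
  reflect (i F G) d = λ s a →
    reflect G (mp (⊢-weaken s d) (reify F (good-⊑ (left here) (⊢-good d)) a))
  reflect (n F)   d = λ s a K g →
    ⊢-contradiction g (reify F (good-⊑ (neg here) (⊢-good d)) a) (⊢-weaken s d)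

  ⊩-axiom : ∀ {X} → H X → ∀ σ {Γ} → Γ ⊩ X [ σ ]
  ⊩-axiom h1 σ = λ _ a s _ → ⊩-mono (σ 0) s a
  ⊩-axiom h2 σ = λ _ f s g t a → f (⊆-trans s t) a ⊆-refl (g t a)
  ⊩-axiom h3 σ = λ _ f s a → f s a ⊆-refl a
  ⊩-axiom h4 σ = λ _ a s k → ⊩-absurd (σ 1) (k ⊆-refl (⊩-mono (σ 0) s a))

  -- Soundness of condensed detachment for the model

  Valid : Formula → Set
  Valid F = ∀ σ {Γ} → Γ ⊩ F [ σ ]

  valid-variant : ∀ {F G} → Variant F G → Valid F → Valid G
  valid-variant {F} (ρ , _ , refl) f σ {Γ} = subst (Γ ⊩_) (sym ([]-∘ F (var ∘ ρ) σ)) (f (σ ∘ ρ))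

  -- For an instance `τ` of the conclusion, both premisses are taken at `σ` followed by `τ`, where
  -- the antecedent and the minor premiss coincide.
  valid-detachment : ∀ {P Q D} → CondensedDetachment P Q D → Valid P → Valid Q → Valid D
  valid-detachment d p q = valid-variant conclusion λ τ {Γ} →
    subst (Γ ⊩_) (sym ([]-∘ B σ τ))
      (valid-variant major p (λ x → σ x [ τ ]) ⊆-refl
        (subst (Γ ⊩_) (trans (sym ([]-∘ C σ τ)) (trans (cong _[ τ ] (sym (proj₁ mgu))) ([]-∘ A σ τ)))
          (valid-variant minor q (λ x → σ x [ τ ]))))
    where open CondensedDetachment d

  soundness : ∀ {Γ} → IsProof H Γ → All Valid Γ
  soundness empty          = []
  soundness (axiom p h w)  = valid-variant w (⊩-axiom h) ∷ soundness p
  soundness (detach π p q d) =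
    valid-detachment d (All.lookup (soundness π) p) (All.lookup (soundness π) q) ∷ soundness π

  -- From derivations back to condensed detachment proofs

  ⊢⇒thm : ∀ {F} → [] ⊢ F → Thm F
  ⊢⇒thm (ax h σ g) = axiom-instance h σ g
  ⊢⇒thm (mp d e)   = modus-ponens (⊢⇒thm d) (⊢⇒thm e)

  linearise : ∀ {F} → Thm F → ∃[ Δ ] (IsProof H (F ∷ Δ) × All Good (F ∷ Δ))
  linearise (axiom h w g)    = [] , axiom empty h w , g ∷ []
  linearise (detach {P} {Q} p q d g) =
    let Γ , π , a = linearise p ; Δ , κ , b = linearise q
    in (P ∷ Γ) ++ (Q ∷ Δ) ,
       detach (++-proof π κ) (here refl) (∈-++⁺ʳ (P ∷ Γ) (here refl)) d , g ∷ ++⁺ a b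

theorem9 : (A : Formula) → Provable H A →
    ∃[ Γ ] IsProofOf H Γ A × (∀ B → DoublyNegated B → OccursIn B Γ → B ⊑ A)
theorem9 A (_ , π , Δ₀ , refl) =
  let valid      = All.head (soundness A π)
      -- The empty world and the identity substitution turn validity into a derivation of `A`
      -- without hypotheses.
      derivation = reify A A (good-self A) (subst ([] ⊩A_) ([]-var A) (valid var))
      Δ , κ , g  = linearise A (⊢⇒thm A derivation)
  in A ∷ Δ , (κ , Δ , refl) , λ B d (L , L∈ , B⊑L) → All.lookup g L∈ d B⊑L
  where
  _⊩A_ : List Formula → Formula → Set
  _⊩A_ = _⊩_ A
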